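{- Let $n\ge 2$ be an integer and let $\lambda\in(0,1)$. Then $$\sum_{k=1}^{n-1}\left(M\left(\left[\frac{n-1}{k}\right]\right)\lambda^{n-k+1}\right)\ >\ \lambda^{n+1}.$$
   Context: Here $\mu$ denotes the Möbius function on the positive integers: $\mu(1)=1$; $\mu(m)=0$ if $m$ is divisible by the square of an integer greater than $1$; and $\mu(m)=(-1)^r$ if $m$ is the product of $r$ pairwise distinct primes. The Mertens function is $M(N)=\sum_{m=1}^{N}\mu(m)$ for positive integers $N$. For positive integers $a,k$ with $k\le a$, $\left[\frac{a}{k}\right]$ denotes the largest integer $j$ with $j\le \frac{a}{k}$ (the floor). -}

module Defs where

open import Algebra.Bundles using (CommutativeMonoid)
import Algebra.Properties.CommutativeSemigroup as CommSemigroup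
import Algebra.Properties.Ring as Ring
open import Data.Bool.Base using (if_then_else_)
open import Data.Integer.Base as ℤ using (ℤ; 0ℤ; -1ℤ)
open import Data.List.Base using (length)
open import Data.Nat.Base as ℕ using (ℕ; zero; suc; NonZero)
open import Data.Nat.Divisibility using (_∣_; _∣?_; m∣m*n; ∣-trans; ∣⇒≤)
import Data.Nat.Properties as ℕ
open import Data.Nat.Primality.Factorisation using (factors; factorise)
open import Data.Product.Base using (∃-syntax; _×_; _,_)
open import Data.Rational.Base as ℚ using (ℚ; 0ℚ; 1ℚ; ½; ∣_∣)
import Data.Rational.Properties as ℚ
open import Relation.Binary.PropositionalEquality
  using (_≡_; sym; trans; cong; cong₂; subst)
open import Relation.Nullary.Decidable using (Dec; map′; _×-dec_; ⌊_⌋)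

-- ∑₁ _⊕_ e N f = f 1 ⊕ … ⊕ f N, with value e for N = 0.
∑₁ : {A : Set} → (A → A → A) → A → ℕ → ((k : ℕ) .{{_ : NonZero k}} → A) → A
∑₁ _⊕_ e zero    f = e
∑₁ _⊕_ e (suc N) f = ∑₁ _⊕_ e N f ⊕ f (suc N)

HasSquareDivisor : ℕ → Set
HasSquareDivisor m = ∃[ d ] 1 ℕ.< d × d ℕ.* d ∣ m

hasSquareDivisor? : ∀ m .{{_ : NonZero m}} → Dec (HasSquareDivisor m)
hasSquareDivisor? m = map′
  (λ (d , _ , h) → d , h)
  (λ (d , 1<d , d²∣m) → d , ℕ.s≤s (∣⇒≤ (∣-trans (m∣m*n d) d²∣m)) , 1<d , d²∣m)
  (ℕ.anyUpTo? (λ d → (1 ℕ.<? d) ×-dec (d ℕ.* d ∣? m)) (suc m))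

-- `factors` lists primes with multiplicity; for m without a square divisor
-- they are pairwise distinct, so the length is the number r of primes.
μ : (m : ℕ) .{{_ : NonZero m}} → ℤ
μ m = if ⌊ hasSquareDivisor? m ⌋
      then 0ℤ
      else -1ℤ ℤ.^ length (factors (factorise m))

M : ℕ → ℤ
M N = ∑₁ ℤ._+_ 0ℤ N (λ m → μ m)

Eventually : (ℕ → Set) → Set
Eventually P = ∃[ N ] (∀ m → N ℕ.≤ m → P m)

Cauchy : (ℕ → ℚ) → Set
Cauchy s = ∀ ε → 0ℚ ℚ.< ε →
  ∃[ N ] (∀ m n → N ℕ.≤ m → N ℕ.≤ n → ∣ s m ℚ.- s n ∣ ℚ.< ε)

-- Real numbers as Cauchy sequences of rationals.  As there are no quotient
-- types, equality of reals is the relation _≃ℝ_, which the operations and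
-- the order below respect.
record ℝ : Set where
  constructor mkℝ
  field
    seq    : ℕ → ℚ
    cauchy : Cauchy seq

open ℝ public

infix  4 _≃ℝ_ _<ℝ_ _>ℝ_
infixl 6 _+ℝ_
infixl 7 _*ℝ_
infixr 8 _^ℝ_

_≃ℝ_ : ℝ → ℝ → Set
x ≃ℝ y = ∀ ε → 0ℚ ℚ.< ε → Eventually (λ m → ∣ seq x m ℚ.- seq y m ∣ ℚ.< ε)

-- Bare termwise inequality would not give strictness in the limit: the
-- terms must eventually be separated by a fixed positive rational.
_<ℝ_ : ℝ → ℝ → Set
x <ℝ y = ∃[ ε ] 0ℚ ℚ.< ε × Eventually (λ m → ε ℚ.< seq y m ℚ.- seq x m)

_>ℝ_ : ℝ → ℝ → Set
x >ℝ y = y <ℝ x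

private
  open CommSemigroup (CommutativeMonoid.commutativeSemigroup ℚ.+-0-commutativeMonoid)
    using (interchange)
  open Ring ℚ.+-*-ring using (x[y-z]≈xy-xz; [y-z]x≈yx-zx)

  minus-plus : ∀ a b → (a ℚ.- b) ℚ.+ b ≡ a
  minus-plus a b = trans (ℚ.+-assoc a (ℚ.- b) b)
    (trans (cong (a ℚ.+_) (ℚ.+-inverseˡ b)) (ℚ.+-identityʳ a))

  half : ∀ {ε} → 0ℚ ℚ.< ε → 0ℚ ℚ.< ½ ℚ.* ε
  half 0<ε = ℚ.*-monoʳ-<-pos ½ 0<ε

  half+half : ∀ ε → ½ ℚ.* ε ℚ.+ ½ ℚ.* ε ≡ ε
  half+half ε = trans (sym (ℚ.*-distribʳ-+ ε ½ ½)) (ℚ.*-identityˡ ε)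

  const-cauchy : ∀ q → Cauchy (λ _ → q)
  const-cauchy q ε 0<ε =
    0 , λ _ _ _ _ → subst (λ d → ∣ d ∣ ℚ.< ε) (sym (ℚ.+-inverseʳ q)) 0<ε

  +-cauchy : ∀ {s t} → Cauchy s → Cauchy t → Cauchy (λ m → s m ℚ.+ t m)
  +-cauchy {s} {t} cs ct ε 0<ε
    with cs (½ ℚ.* ε) (half 0<ε) | ct (½ ℚ.* ε) (half 0<ε)
  ... | N₁ , h₁ | N₂ , h₂ = N₁ ℕ.⊔ N₂ , λ m n N≤m N≤n → begin-strict
      ∣ (s m ℚ.+ t m) ℚ.- (s n ℚ.+ t n) ∣
        ≡⟨ cong ∣_∣ (rearrange (s m) (t m) (s n) (t n)) ⟩
      ∣ (s m ℚ.- s n) ℚ.+ (t m ℚ.- t n) ∣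
        ≤⟨ ℚ.∣p+q∣≤∣p∣+∣q∣ (s m ℚ.- s n) (t m ℚ.- t n) ⟩
      ∣ s m ℚ.- s n ∣ ℚ.+ ∣ t m ℚ.- t n ∣
        <⟨ ℚ.+-mono-<
             (h₁ m n (ℕ.m⊔n≤o⇒m≤o N₁ N₂ N≤m) (ℕ.m⊔n≤o⇒m≤o N₁ N₂ N≤n))
             (h₂ m n (ℕ.m⊔n≤o⇒n≤o N₁ N₂ N≤m) (ℕ.m⊔n≤o⇒n≤o N₁ N₂ N≤n)) ⟩
      ½ ℚ.* ε ℚ.+ ½ ℚ.* ε
        ≡⟨ half+half ε ⟩
      ε ∎
    where
    open ℚ.≤-Reasoning
    rearrange : ∀ a b c d →
      (a ℚ.+ b) ℚ.- (c ℚ.+ d) ≡ (a ℚ.- c) ℚ.+ (b ℚ.- d)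
    rearrange a b c d = trans (cong (a ℚ.+ b ℚ.+_) (ℚ.neg-distrib-+ c d))
      (interchange a b (ℚ.- c) (ℚ.- d))

  EventuallyBounded : (ℕ → ℚ) → Set
  EventuallyBounded s =
    ∃[ B ] ℚ.Positive B × Eventually (λ m → ∣ s m ∣ ℚ.≤ B)

  cauchy⇒bounded : ∀ {s} → Cauchy s → EventuallyBounded s
  cauchy⇒bounded {s} cs with cs 1ℚ (ℚ.positive⁻¹ 1ℚ)
  ... | N , h = 1ℚ ℚ.+ ∣ s N ∣ , ℚ.positive 0<B , N , λ m N≤m → begin
      ∣ s m ∣                      ≡⟨ cong ∣_∣ (sym (minus-plus (s m) (s N))) ⟩
      ∣ (s m ℚ.- s N) ℚ.+ s N ∣    ≤⟨ ℚ.∣p+q∣≤∣p∣+∣q∣ (s m ℚ.- s N) (s N) ⟩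
      ∣ s m ℚ.- s N ∣ ℚ.+ ∣ s N ∣  ≤⟨ ℚ.+-monoˡ-≤ ∣ s N ∣
                                       (ℚ.<⇒≤ (h m N N≤m ℕ.≤-refl)) ⟩
      1ℚ ℚ.+ ∣ s N ∣               ∎
    where
    open ℚ.≤-Reasoning
    0<B : 0ℚ ℚ.< 1ℚ ℚ.+ ∣ s N ∣
    0<B = ℚ.+-mono-<-≤ (ℚ.positive⁻¹ 1ℚ) (ℚ.0≤∣p∣ (s N))

  *-bound : ∀ p q {B δ} → ℚ.Positive B → ∣ p ∣ ℚ.≤ B → ∣ q ∣ ℚ.< δ →
            ∣ p ℚ.* q ∣ ℚ.< B ℚ.* δ
  *-bound p q {B} {δ} B⁺ p≤B q<δ = begin-strict
      ∣ p ℚ.* q ∣      ≡⟨ ℚ.∣p*q∣≡∣p∣*∣q∣ p q ⟩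
      ∣ p ∣ ℚ.* ∣ q ∣  ≤⟨ ℚ.*-monoʳ-≤-nonNeg ∣ q ∣ {{ℚ.∣-∣-nonNeg q}} p≤B ⟩
      B ℚ.* ∣ q ∣      <⟨ ℚ.*-monoʳ-<-pos B {{B⁺}} q<δ ⟩
      B ℚ.* δ          ∎
    where open ℚ.≤-Reasoning

  *-cauchy : ∀ {s t} → Cauchy s → Cauchy t → Cauchy (λ m → s m ℚ.* t m)
  *-cauchy {s} {t} cs ct ε 0<ε with cauchy⇒bounded cs | cauchy⇒bounded ct
  ... | A , A⁺ , K₁ , b₁ | B , B⁺ , K₂ , b₂
    with cs (share B B⁺) (share-pos B B⁺) | ct (share A A⁺) (share-pos A A⁺)
    where
    share : ∀ C → ℚ.Positive C → ℚ
    share C C⁺ = ℚ.1/_ C {{ℚ.pos⇒nonZero C {{C⁺}}}} ℚ.* (½ ℚ.* ε)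
    share-pos : ∀ C (C⁺ : ℚ.Positive C) → 0ℚ ℚ.< share C C⁺
    share-pos C C⁺ = subst (ℚ._< share C C⁺) (ℚ.*-zeroʳ C⁻¹)
      (ℚ.*-monoʳ-<-pos C⁻¹ {{ℚ.1/pos⇒pos C {{C⁺}}}} (half 0<ε))
      where C⁻¹ = ℚ.1/_ C {{ℚ.pos⇒nonZero C {{C⁺}}}}
  ... | N₁ , h₁ | N₂ , h₂ =
      (K₁ ℕ.⊔ K₂) ℕ.⊔ (N₁ ℕ.⊔ N₂) , λ m n N≤m N≤n →
        let K≤m = ℕ.m⊔n≤o⇒m≤o (K₁ ℕ.⊔ K₂) (N₁ ℕ.⊔ N₂) N≤m
            K≤n = ℕ.m⊔n≤o⇒m≤o (K₁ ℕ.⊔ K₂) (N₁ ℕ.⊔ N₂) N≤n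
            L≤m = ℕ.m⊔n≤o⇒n≤o (K₁ ℕ.⊔ K₂) (N₁ ℕ.⊔ N₂) N≤m
            L≤n = ℕ.m⊔n≤o⇒n≤o (K₁ ℕ.⊔ K₂) (N₁ ℕ.⊔ N₂) N≤n
        in begin-strict
      ∣ s m ℚ.* t m ℚ.- s n ℚ.* t n ∣
        ≡⟨ cong ∣_∣ (rearrange (s m) (t m) (s n) (t n)) ⟩
      ∣ s m ℚ.* (t m ℚ.- t n) ℚ.+ t n ℚ.* (s m ℚ.- s n) ∣
        ≤⟨ ℚ.∣p+q∣≤∣p∣+∣q∣ (s m ℚ.* (t m ℚ.- t n)) (t n ℚ.* (s m ℚ.- s n)) ⟩
      ∣ s m ℚ.* (t m ℚ.- t n) ∣ ℚ.+ ∣ t n ℚ.* (s m ℚ.- s n) ∣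
        <⟨ ℚ.+-mono-<
             (*-bound (s m) (t m ℚ.- t n) A⁺
               (b₁ m (ℕ.m⊔n≤o⇒m≤o K₁ K₂ K≤m))
               (h₂ m n (ℕ.m⊔n≤o⇒n≤o N₁ N₂ L≤m) (ℕ.m⊔n≤o⇒n≤o N₁ N₂ L≤n)))
             (*-bound (t n) (s m ℚ.- s n) B⁺
               (b₂ n (ℕ.m⊔n≤o⇒n≤o K₁ K₂ K≤n))
               (h₁ m n (ℕ.m⊔n≤o⇒m≤o N₁ N₂ L≤m) (ℕ.m⊔n≤o⇒m≤o N₁ N₂ L≤n))) ⟩
      A ℚ.* _ ℚ.+ B ℚ.* _
        ≡⟨ cong₂ ℚ._+_ (cancel A A⁺) (cancel B B⁺) ⟩
      ½ ℚ.* ε ℚ.+ ½ ℚ.* ε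
        ≡⟨ half+half ε ⟩
      ε ∎
    where
    open ℚ.≤-Reasoning
    cancel : ∀ C (C⁺ : ℚ.Positive C) →
      C ℚ.* (ℚ.1/_ C {{ℚ.pos⇒nonZero C {{C⁺}}}} ℚ.* (½ ℚ.* ε)) ≡ ½ ℚ.* ε
    cancel C C⁺ = trans (sym (ℚ.*-assoc C _ (½ ℚ.* ε)))
      (trans (cong (ℚ._* (½ ℚ.* ε)) (ℚ.*-inverseʳ C {{ℚ.pos⇒nonZero C {{C⁺}}}}))
             (ℚ.*-identityˡ (½ ℚ.* ε)))
    rearrange : ∀ a b c d → a ℚ.* b ℚ.- c ℚ.* d
              ≡ a ℚ.* (b ℚ.- d) ℚ.+ d ℚ.* (a ℚ.- c)
    rearrange a b c d = sym (trans
      (cong₂ ℚ._+_ (x[y-z]≈xy-xz a b d)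
                   (trans (ℚ.*-comm d (a ℚ.- c)) ([y-z]x≈yx-zx d a c)))
      (trans (sym (ℚ.+-assoc (a ℚ.* b ℚ.- a ℚ.* d) (a ℚ.* d) _))
             (cong (ℚ._- c ℚ.* d) (minus-plus (a ℚ.* b) (a ℚ.* d)))))

fromℚ : ℚ → ℝ
fromℚ q = mkℝ (λ _ → q) (const-cauchy q)

fromℤ : ℤ → ℝ
fromℤ z = fromℚ (z ℚ./ 1)

0ℝ 1ℝ : ℝ
0ℝ = fromℚ 0ℚ
1ℝ = fromℚ 1ℚ

_+ℝ_ : ℝ → ℝ → ℝ
x +ℝ y = mkℝ (λ m → seq x m ℚ.+ seq y m) (+-cauchy {seq x} {seq y} (cauchy x) (cauchy y))

_*ℝ_ : ℝ → ℝ → ℝ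
x *ℝ y = mkℝ (λ m → seq x m ℚ.* seq y m) (*-cauchy {seq x} {seq y} (cauchy x) (cauchy y))

_^ℝ_ : ℝ → ℕ → ℝ
x ^ℝ zero  = 1ℝ
x ^ℝ suc n = x *ℝ (x ^ℝ n)

∑ℝ : ℕ → ((k : ℕ) .{{_ : NonZero k}} → ℝ) → ℝ
∑ℝ = ∑₁ _+ℝ_ 0ℝ

{-# OPTIONS --safe #-}

-- Put t = 1/λ > 1 and N = n - 1.  Dividing by λ^(n+1), one has to show that
-- Σ_{k≤N} M([N/k]) t^k = Σ_{j≤N} P_j(t) exceeds 1, where P_j(t) = Σ_{d∣j} μ(j/d) t^d.
-- As P_1(t) = t > 1, it suffices that P_j(t) ≥ 0.  Peeling off one prime factor p of j at a
-- time turns the sum Σ_{d∣pm} w(pm/d) f(d) into the same kind of sum over the divisors of m,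
-- with f(d) replaced by f(pd) - f(d) or by f(pd), and these operations preserve the
-- polynomials with nonnegative coefficients in the (for t ≥ 1 nonnegative) functions
-- t^(ad) and t^(ad) - 1 of d.

module Submission where

open import Defs
open import Data.Nat using (ℕ; _+_; _∸_; _/_; _≤_)
open import Data.Nat.Base as ℕ using (zero; suc; NonZero; _*_; _<_; _%_; s≤s)
import Data.Nat.Properties as ℕ
import Data.Nat.DivMod as ℕ
open import Data.Nat.Coprimality using (Coprime; coprime-divisor)
open import Data.Nat.Divisibility
open import Data.Nat.ListAction using (product)
open import Data.Nat.Primality
open import Data.Nat.Primality.Factorisation
open import Data.Integer.Base as ℤ using (ℤ; 0ℤ; -1ℤ)
import Data.Integer.Properties as ℤ
open import Data.List.Base using ([]; _∷_; length)
open import Data.List.Relation.Unary.All using (All; []; _∷_)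
open import Data.List.Relation.Binary.Permutation.Propositional.Properties using (↭-length)
open import Data.Product.Base using (_,_)
open import Data.Rational.Base as ℚ using (ℚ; 0ℚ; 1ℚ; -_)
import Data.Rational.Properties as ℚ
import Data.Rational.Unnormalised.Base as ℚᵘ
import Data.Rational.Unnormalised.Properties as ℚᵘ
open import Data.Rational.Solver using (module +-*-Solver)
open import Data.Sum.Base using (_⊎_; inj₁; inj₂)
open import Function.Base using (_∘_)
open import Relation.Binary.PropositionalEquality
open import Relation.Nullary using (¬_; yes; no; contradiction)

open +-*-Solver using (solve; _:=_; _:+_; _:*_; _:-_; con)

-- Powers and inequalities of rationals.

infixr 8 _^_

_^_ : ℚ → ℕ → ℚ
q ^ zero  = 1ℚ
q ^ suc n = q ℚ.* q ^ n

^-+ : ∀ q m n → q ^ (m + n) ≡ q ^ m ℚ.* q ^ n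
^-+ q zero    n = sym (ℚ.*-identityˡ (q ^ n))
^-+ q (suc m) n = trans (cong (q ℚ.*_) (^-+ q m n)) (sym (ℚ.*-assoc q (q ^ m) (q ^ n)))

*-nonNeg : ∀ {p q} → 0ℚ ℚ.≤ p → 0ℚ ℚ.≤ q → 0ℚ ℚ.≤ p ℚ.* q
*-nonNeg {p} {q} 0≤p 0≤q = ℚ.nonNegative⁻¹ (p ℚ.* q)
  {{ℚ.nonNeg*nonNeg⇒nonNeg p {{ℚ.nonNegative 0≤p}} q {{ℚ.nonNegative 0≤q}}}}

*-pos : ∀ {p q} → 0ℚ ℚ.< p → 0ℚ ℚ.< q → 0ℚ ℚ.< p ℚ.* q
*-pos {p} {q} 0<p 0<q = ℚ.positive⁻¹ (p ℚ.* q)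
  {{ℚ.pos*pos⇒pos p {{ℚ.positive 0<p}} q {{ℚ.positive 0<q}}}}

p≤q⇒0≤q-p : ∀ {p q} → p ℚ.≤ q → 0ℚ ℚ.≤ q ℚ.- p
p≤q⇒0≤q-p {p} {q} p≤q = subst (ℚ._≤ q ℚ.- p) (ℚ.+-inverseʳ p) (ℚ.+-monoˡ-≤ (- p) p≤q)

1≤^ : ∀ {t} → 1ℚ ℚ.≤ t → ∀ n → 1ℚ ℚ.≤ t ^ n
1≤^ {t} 1≤t zero    = ℚ.≤-refl
1≤^ {t} 1≤t (suc n) = begin
  1ℚ           ≤⟨ 1≤t ⟩
  t            ≡⟨ ℚ.*-identityʳ t ⟨
  t ℚ.* 1ℚ     ≤⟨ ℚ.*-monoˡ-≤-nonNeg t {{ℚ.nonNegative 0≤t}} (1≤^ 1≤t n) ⟩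
  t ℚ.* t ^ n  ∎
  where
  open ℚ.≤-Reasoning
  0≤t : 0ℚ ℚ.≤ t
  0≤t = ℚ.≤-trans (ℚ.nonNegative⁻¹ 1ℚ) 1≤t

^-pos : ∀ {q} → 0ℚ ℚ.< q → ∀ n → 0ℚ ℚ.< q ^ n
^-pos 0<q zero    = ℚ.positive⁻¹ 1ℚ
^-pos 0<q (suc n) = *-pos 0<q (^-pos 0<q n)

^-mono-≤ : ∀ {p q} → 0ℚ ℚ.< p → p ℚ.< q → ∀ n → p ^ n ℚ.≤ q ^ n
^-mono-≤         0<p p<q zero    = ℚ.≤-refl
^-mono-≤ {p} {q} 0<p p<q (suc n) = ℚ.≤-trans
  (ℚ.*-monoʳ-≤-nonNeg (p ^ n) {{ℚ.nonNegative (ℚ.<⇒≤ (^-pos 0<p n))}} (ℚ.<⇒≤ p<q))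
  (ℚ.*-monoˡ-≤-nonNeg q {{ℚ.nonNegative (ℚ.<⇒≤ (ℚ.<-trans 0<p p<q))}} (^-mono-≤ 0<p p<q n))

-- This undoes the division by `λ^(n+1)`: for `t = 1/λ` it turns `λ^(n+1) t^k` back into
-- `λ^(n-k+1)`.
^-inverse : ∀ {q t} → q ℚ.* t ≡ 1ℚ → ∀ m n → q ^ (m + n) ℚ.* t ^ n ≡ q ^ m
^-inverse {q} {t} qt≡1 m n = begin
  q ^ (m + n) ℚ.* t ^ n        ≡⟨ cong (ℚ._* t ^ n) (^-+ q m n) ⟩
  q ^ m ℚ.* q ^ n ℚ.* t ^ n    ≡⟨ ℚ.*-assoc (q ^ m) (q ^ n) (t ^ n) ⟩
  q ^ m ℚ.* (q ^ n ℚ.* t ^ n)  ≡⟨ cong (q ^ m ℚ.*_) (cancel n) ⟩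
  q ^ m ℚ.* 1ℚ                 ≡⟨ ℚ.*-identityʳ (q ^ m) ⟩
  q ^ m                        ∎
  where
  open ≡-Reasoning
  cancel : ∀ n → q ^ n ℚ.* t ^ n ≡ 1ℚ
  cancel zero    = refl
  cancel (suc n) = begin
    q ℚ.* q ^ n ℚ.* (t ℚ.* t ^ n)
      ≡⟨ solve 4 (λ a b c d → a :* b :* (c :* d) := a :* c :* (b :* d)) refl q (q ^ n) t (t ^ n) ⟩
    q ℚ.* t ℚ.* (q ^ n ℚ.* t ^ n)
      ≡⟨ cong₂ ℚ._*_ qt≡1 (cancel n) ⟩
    1ℚ ∎

-- Finite sums of rationals.

-- ∑ n f = f 0 + … + f (n - 1).
∑ : ℕ → (ℕ → ℚ) → ℚ
∑ zero    f = 0ℚ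
∑ (suc n) f = f 0 ℚ.+ ∑ n (f ∘ suc)

∑-cong : ∀ n {f g} → (∀ {i} → i < n → f i ≡ g i) → ∑ n f ≡ ∑ n g
∑-cong zero    eq = refl
∑-cong (suc n) eq = cong₂ ℚ._+_ (eq ℕ.z<s) (∑-cong n (eq ∘ s≤s))

∑-zero : ∀ n {f} → (∀ i → f i ≡ 0ℚ) → ∑ n f ≡ 0ℚ
∑-zero zero    eq = refl
∑-zero (suc n) eq = cong₂ ℚ._+_ (eq 0) (∑-zero n (eq ∘ suc))

∑-linear : ∀ n c f g → ∑ n (λ i → f i ℚ.+ c ℚ.* g i) ≡ ∑ n f ℚ.+ c ℚ.* ∑ n g
∑-linear zero    c f g = sym (trans (ℚ.+-identityˡ _) (ℚ.*-zeroʳ c))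
∑-linear (suc n) c f g = trans (cong (f 0 ℚ.+ c ℚ.* g 0 ℚ.+_) (∑-linear n c (f ∘ suc) (g ∘ suc)))
  (solve 5 (λ c a b x y → a :+ c :* b :+ (x :+ c :* y) := a :+ x :+ c :* (b :+ y)) refl
    c (f 0) (g 0) (∑ n (f ∘ suc)) (∑ n (g ∘ suc)))

∑-+ : ∀ n f g → ∑ n (λ i → f i ℚ.+ g i) ≡ ∑ n f ℚ.+ ∑ n g
∑-+ n f g = trans (∑-cong n (λ {i} _ → cong (f i ℚ.+_) (sym (ℚ.*-identityˡ (g i)))))
  (trans (∑-linear n 1ℚ f g) (cong (∑ n f ℚ.+_) (ℚ.*-identityˡ (∑ n g))))

∑-- : ∀ n f g → ∑ n (λ i → f i ℚ.- g i) ≡ ∑ n f ℚ.- ∑ n g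
∑-- n f g = trans (∑-cong n (λ {i} _ → -≡+-1* (f i) (g i)))
  (trans (∑-linear n (- 1ℚ) f g) (sym (-≡+-1* (∑ n f) (∑ n g))))
  where
  -≡+-1* : ∀ a b → a ℚ.- b ≡ a ℚ.+ (- 1ℚ) ℚ.* b
  -≡+-1* = solve 2 (λ a b → a :- b := a :+ con (- 1ℚ) :* b) refl

∑-* : ∀ n c f → ∑ n (λ i → c ℚ.* f i) ≡ c ℚ.* ∑ n f
∑-* zero    c f = sym (ℚ.*-zeroʳ c)
∑-* (suc n) c f = trans (cong (c ℚ.* f 0 ℚ.+_) (∑-* n c (f ∘ suc)))
  (sym (ℚ.*-distribˡ-+ c (f 0) (∑ n (f ∘ suc))))

∑-split : ∀ m n f → ∑ (m + n) f ≡ ∑ m f ℚ.+ ∑ n (λ i → f (m + i))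
∑-split zero    n f = sym (ℚ.+-identityˡ (∑ n f))
∑-split (suc m) n f = trans (cong (f 0 ℚ.+_) (∑-split m n (f ∘ suc)))
  (sym (ℚ.+-assoc (f 0) (∑ m (f ∘ suc)) _))

∑-last : ∀ n f → ∑ (suc n) f ≡ ∑ n f ℚ.+ f n
∑-last zero    f = ℚ.+-comm (f 0) 0ℚ
∑-last (suc n) f = trans (cong (f 0 ℚ.+_) (∑-last n (f ∘ suc)))
  (sym (ℚ.+-assoc (f 0) (∑ n (f ∘ suc)) _))

∑-extend : ∀ {m n} f → m ≤ n → (∀ i → m ≤ i → f i ≡ 0ℚ) → ∑ n f ≡ ∑ m f
∑-extend {m} {n} f m≤n f≡0 = begin
  ∑ n f                                  ≡⟨ cong (λ l → ∑ l f) (ℕ.m+[n∸m]≡n m≤n) ⟨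
  ∑ (m + (n ∸ m)) f                      ≡⟨ ∑-split m (n ∸ m) f ⟩
  ∑ m f ℚ.+ ∑ (n ∸ m) (λ i → f (m + i))  ≡⟨ cong (∑ m f ℚ.+_)
                                              (∑-zero (n ∸ m) (λ i → f≡0 (m + i) (ℕ.m≤m+n m i))) ⟩
  ∑ m f ℚ.+ 0ℚ                           ≡⟨ ℚ.+-identityʳ (∑ m f) ⟩
  ∑ m f                                  ∎
  where open ≡-Reasoning

-- The range is cut into `n` blocks of length `p`; in each block only the first index is a multiple
-- of `p`.
∑-multiples : ∀ p .{{_ : NonZero p}} n f → (∀ k → ¬ p ∣ k → f k ≡ 0ℚ) →
  ∑ (n * p) f ≡ ∑ n (λ k → f (k * p))
∑-multiples p           zero    f f≡0 = refl
∑-multiples p@(suc p-1) (suc n) f f≡0 = begin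
  ∑ (p + n * p) f
    ≡⟨ ∑-split p (n * p) f ⟩
  f 0 ℚ.+ ∑ p-1 (f ∘ suc) ℚ.+ ∑ (n * p) (λ i → f (p + i))
    ≡⟨ cong (ℚ._+ ∑ (n * p) (λ i → f (p + i))) block ⟩
  f 0 ℚ.+ ∑ (n * p) (λ i → f (p + i))
    ≡⟨ cong (f 0 ℚ.+_) (∑-multiples p n (λ i → f (p + i))
         (λ k p∤k → f≡0 (p + k) (λ p∣p+k → p∤k (∣m+n∣m⇒∣n p∣p+k ∣-refl)))) ⟩
  f 0 ℚ.+ ∑ n (λ k → f (p + k * p)) ∎
  where
  open ≡-Reasoning
  block : ∑ p f ≡ f 0
  block = trans (cong (f 0 ℚ.+_) (trans
      (∑-cong p-1 {g = λ _ → 0ℚ} (λ {i} i<p-1 → f≡0 (suc i) (>⇒∤ (s≤s i<p-1))))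
      (∑-zero p-1 (λ _ → refl))))
    (ℚ.+-identityʳ (f 0))

-- Exact quotients and weights of Möbius type.

-- Junk value 0 when k does not divide n.
quot : ℕ → ℕ → ℕ
quot n k with k ∣? n
... | yes (divides q _) = q
... | no  _             = 0

quot-* : ∀ q k .{{_ : NonZero k}} → quot (q * k) k ≡ q
quot-* q k with k ∣? q * k
... | yes (divides r eq) = ℕ.*-cancelʳ-≡ r q k (sym eq)
... | no  k∤             = contradiction (n∣m*n q) k∤

quot-∤ : ∀ {n k} → ¬ k ∣ n → quot n k ≡ 0
quot-∤ {n} {k} k∤n with k ∣? n
... | yes k∣n = contradiction k∣n k∤n
... | no  _   = refl

quot-*-* : ∀ n k p .{{_ : NonZero n}} .{{_ : NonZero p}} → quot (n * p) (k * p) ≡ quot n k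
quot-*-* n k p with k ∣? n
... | no  k∤n = quot-∤ (λ kp∣np → k∤n (*-cancelʳ-∣ p kp∣np))
quot-*-* n zero p {{nz}} | yes (divides q eq) =
  contradiction (trans eq (ℕ.*-zeroʳ q)) (ℕ.≢-nonZero⁻¹ n)
quot-*-* n k@(suc _) p   | yes (divides q eq) = begin
  quot (n * p) (k * p)        ≡⟨ cong (λ m → quot (m * p) (k * p)) eq ⟩
  quot (q * k * p) (k * p)    ≡⟨ cong (λ m → quot m (k * p)) (ℕ.*-assoc q k p) ⟩
  quot (q * (k * p)) (k * p)  ≡⟨ quot-* q (k * p) {{ℕ.m*n≢0 k p}} ⟩
  q                           ∎
  where open ≡-Reasoning

-- For `w = μ`, the single formula `- sieve p w e` covers both cases of `μ(ep)`: zero if `p` divides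
-- `e`, and `-μ(e)` otherwise.
sieve : ℕ → (ℕ → ℚ) → ℕ → ℚ
sieve p w d with p ∣? d
... | yes _ = 0ℚ
... | no  _ = w d

sieve-∣ : ∀ {p d} w → p ∣ d → sieve p w d ≡ 0ℚ
sieve-∣ {p} {d} w p∣d with p ∣? d
... | yes _   = refl
... | no  p∤d = contradiction p∣d p∤d

sieve-∤ : ∀ {p d} w → ¬ p ∣ d → sieve p w d ≡ w d
sieve-∤ {p} {d} w p∤d with p ∣? d
... | yes p∣d = contradiction p∣d p∤d
... | no  _   = refl

-- Satisfied by μ and by its restriction to the integers coprime to a fixed one.
record MöbiusLike (w : ℕ → ℚ) : Set where
  field
    w[0]    : w 0 ≡ 0ℚ
    w[1]    : w 1 ≡ 1ℚ
    atPrime : ∀ {p} → Prime p →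
              (∀ e → w (e * p) ≡ 0ℚ) ⊎ (∀ e → w (e * p) ≡ - sieve p w e)

open MöbiusLike

prime∣prime⇒≡ : ∀ {p q} → Prime p → Prime q → p ∣ q → p ≡ q
prime∣prime⇒≡ p-prime q-prime p∣q with prime⇒irreducible q-prime p∣q
... | inj₁ refl = contradiction p-prime ¬prime[1]
... | inj₂ p≡q  = p≡q

-- The prime `p` itself falls under the vanishing alternative, all its multiples being sieved out. A
-- prime `q` other than `p` keeps the alternative it had for `w`, since `p` divides `e * q` only if
-- it divides `e`.
sieve-möbiusLike : ∀ {p w} → Prime p → MöbiusLike w → MöbiusLike (sieve p w)
sieve-möbiusLike {p} {w} p-prime W = record
  { w[0]    = sieve-∣ w (p ∣0)
  ; w[1]    = trans (sieve-∤ w p∤1) (w[1] W)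
  ; atPrime = at
  }
  where
  p∤1 : ¬ p ∣ 1
  p∤1 p∣1 = ¬prime[1] (subst Prime (∣1⇒≡1 p∣1) p-prime)

  at : ∀ {q} → Prime q →
    (∀ e → sieve p w (e * q) ≡ 0ℚ) ⊎ (∀ e → sieve p w (e * q) ≡ - sieve q (sieve p w) e)
  at {q} q-prime with p ℕ.≟ q
  ... | yes refl = inj₁ (λ e → sieve-∣ {p} {e * p} w (n∣m*n e))
  ... | no  p≢q with atPrime W q-prime
  ...   | inj₁ vanish = inj₁ zero-at
    where
    zero-at : ∀ e → sieve p w (e * q) ≡ 0ℚ
    zero-at e with p ∣? e * q
    ... | yes _ = refl
    ... | no  _ = vanish e
  ...   | inj₂ flip = inj₂ neg-at
    where
    neg-at : ∀ e → sieve p w (e * q) ≡ - sieve q (sieve p w) e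
    neg-at e with p ∣? e
    ... | yes p∣e = trans (sieve-∣ w (∣m⇒∣m*n q p∣e)) (sym (cong -_ inner))
      where
      inner : sieve q (sieve p w) e ≡ 0ℚ
      inner with q ∣? e
      ... | yes _ = refl
      ... | no  _ = sieve-∣ w p∣e
    ... | no p∤e = trans (sieve-∤ w p∤eq) (trans (flip e) (cong -_ inner))
      where
      p∤eq : ¬ p ∣ e * q
      p∤eq p∣eq with euclidsLemma e q p-prime p∣eq
      ... | inj₁ p∣e = p∤e p∣e
      ... | inj₂ p∣q = p≢q (prime∣prime⇒≡ p-prime q-prime p∣q)
      inner : sieve q w e ≡ sieve q (sieve p w) e
      inner with q ∣? e
      ... | yes _ = refl
      ... | no  _ = sym (sieve-∤ w p∤e)

-- Dirichlet convolution and removal of a prime factor.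

-- The Dirichlet convolution (w ⋆ f) n: terms with k not dividing n vanish as w 0 = 0.
conv : (ℕ → ℚ) → ℕ → (ℕ → ℚ) → ℚ
conv w n f = ∑ (suc n) (λ k → w (quot n k) ℚ.* f k)

conv-term-∤ : ∀ {w : ℕ → ℚ} {n k} (f : ℕ → ℚ) → w 0 ≡ 0ℚ → ¬ k ∣ n → w (quot n k) ℚ.* f k ≡ 0ℚ
conv-term-∤ {w} {n} {k} f w0 k∤n =
  trans (cong (ℚ._* f k) (trans (cong w (quot-∤ k∤n)) w0)) (ℚ.*-zeroˡ (f k))

conv-extend : ∀ {w : ℕ → ℚ} n .{{_ : NonZero n}} {m} (f : ℕ → ℚ) → w 0 ≡ 0ℚ → n < m →
  ∑ m (λ k → w (quot n k) ℚ.* f k) ≡ conv w n f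
conv-extend {w} n f w0 n<m = ∑-extend _ n<m (λ k n<k → conv-term-∤ {w} f w0 (>⇒∤ n<k))

-- Only multiples of `p` contribute: if `k` divides `n * p` and `p` does not divide `k`, then `p`
-- divides the quotient, where `w` vanishes.
conv-vanish : ∀ {w p} n .{{_ : NonZero n}} f → Prime p → w 0 ≡ 0ℚ → (∀ e → w (e * p) ≡ 0ℚ) →
  conv w (n * p) f ≡ conv w n (λ k → f (k * p))
conv-vanish {w} {p} n f p-prime w0 vanish = begin
  conv w (n * p) f
    -- Zero terms beyond `n * p` are added so that the range consists of `suc n` full blocks of
    -- length `p`.
    ≡⟨ conv-extend {w} (n * p) f w0 (ℕ.+-monoˡ-≤ (n * p) (ℕ.>-nonZero⁻¹ p)) ⟨
  ∑ (suc n * p) (λ k → w (quot (n * p) k) ℚ.* f k)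
    ≡⟨ ∑-multiples p (suc n) (λ k → w (quot (n * p) k) ℚ.* f k) off ⟩
  ∑ (suc n) (λ k → w (quot (n * p) (k * p)) ℚ.* f (k * p))
    ≡⟨ ∑-cong (suc n) (λ {k} _ → cong (λ d → w d ℚ.* f (k * p)) (quot-*-* n k p)) ⟩
  conv w n (λ k → f (k * p)) ∎
  where
  open ≡-Reasoning
  instance
    p≢0 : NonZero p
    p≢0 = prime⇒nonZero p-prime
    np≢0 : NonZero (n * p)
    np≢0 = ℕ.m*n≢0 n p
  off : ∀ k → ¬ p ∣ k → w (quot (n * p) k) ℚ.* f k ≡ 0ℚ
  off k p∤k = trans (cong (ℚ._* f k) w≡0) (ℚ.*-zeroˡ (f k))
    where
    w≡0 : w (quot (n * p) k) ≡ 0ℚ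
    w≡0 with k ∣? n * p
    ... | no  _ = w0
    ... | yes (divides q eq) with euclidsLemma q k p-prime (subst (p ∣_) eq (n∣m*n n))
    ...   | inj₂ p∣k              = contradiction p∣k p∤k
    ...   | inj₁ (divides e refl) = vanish e

-- By `weight`, the sum splits into two convolutions with the sieved weight, at `n * p` and at `n`.
-- The sieved weight vanishes on multiples of `p`, so `conv-vanish` brings the first one down to
-- `n`, where the two combine into a difference of `f`.
conv-flip : ∀ {w p} n .{{_ : NonZero n}} f → Prime p → w 0 ≡ 0ℚ →
  (∀ e → w (e * p) ≡ - sieve p w e) →
  conv w (n * p) f ≡ conv (sieve p w) n (λ k → f (k * p) ℚ.- f k)
conv-flip {w} {p} n f p-prime w0 flip = begin
  conv w (n * p) f
    ≡⟨ ∑-cong (suc (n * p)) (λ {k} _ → trans (cong (ℚ._* f k) (weight k))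
         (distrib (w′ (quot (n * p) k)) (w′ (quot n k)) (f k))) ⟩
  ∑ (suc (n * p)) (λ k → w′ (quot (n * p) k) ℚ.* f k ℚ.- w′ (quot n k) ℚ.* f k)
    ≡⟨ ∑-- (suc (n * p)) (λ k → w′ (quot (n * p) k) ℚ.* f k) (λ k → w′ (quot n k) ℚ.* f k) ⟩
  conv w′ (n * p) f ℚ.- ∑ (suc (n * p)) (λ k → w′ (quot n k) ℚ.* f k)
    ≡⟨ cong₂ ℚ._-_ (conv-vanish {w′} n f p-prime w′0 (λ e → sieve-∣ {p} {e * p} w (n∣m*n e)))
                   (conv-extend {w′} n f w′0 (s≤s (ℕ.m≤m*n n p))) ⟩
  conv w′ n (λ k → f (k * p)) ℚ.- conv w′ n f
    ≡⟨ ∑-- (suc n) (λ k → w′ (quot n k) ℚ.* f (k * p)) (λ k → w′ (quot n k) ℚ.* f k) ⟨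
  ∑ (suc n) (λ k → w′ (quot n k) ℚ.* f (k * p) ℚ.- w′ (quot n k) ℚ.* f k)
    ≡⟨ ∑-cong (suc n) (λ {k} _ → factor (w′ (quot n k)) (f (k * p)) (f k)) ⟩
  conv w′ n (λ k → f (k * p) ℚ.- f k) ∎
  where
  open ≡-Reasoning
  instance
    p≢0 : NonZero p
    p≢0 = prime⇒nonZero p-prime
  w′ : ℕ → ℚ
  w′ = sieve p w
  w′0 : w′ 0 ≡ 0ℚ
  w′0 = sieve-∣ w (p ∣0)
  distrib : ∀ a b c → (a ℚ.- b) ℚ.* c ≡ a ℚ.* c ℚ.- b ℚ.* c
  distrib = solve 3 (λ a b c → (a :- b) :* c := a :* c :- b :* c) refl
  factor : ∀ a b c → a ℚ.* b ℚ.- a ℚ.* c ≡ a ℚ.* (b ℚ.- c)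
  factor = solve 3 (λ a b c → a :* b :- a :* c := a :* (b :- c)) refl

  -- If `k` divides `n`, then `p` divides `np/k`, so the first sieved value is zero and `flip` gives
  -- the second. If not, the second is the value at the default quotient 0, hence zero, and sieving
  -- leaves the first unchanged: were `np/k` an integer divisible by `p`, `k` would divide `n`.
  weight : ∀ k → w (quot (n * p) k) ≡ w′ (quot (n * p) k) ℚ.- w′ (quot n k)
  weight k with k ∣? n
  weight zero | yes (divides q eq) =
    contradiction (trans eq (ℕ.*-zeroʳ q)) (ℕ.≢-nonZero⁻¹ n)
  weight k@(suc _) | yes (divides q eq) = begin
    w (quot (n * p) k)                   ≡⟨ cong w eq′ ⟩
    w (q * p)                            ≡⟨ flip q ⟩
    - w′ q                               ≡⟨ ℚ.+-identityˡ (- w′ q) ⟨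
    0ℚ ℚ.- w′ q                          ≡⟨ cong (ℚ._- w′ q) (sieve-∣ {p} {q * p} w (n∣m*n q)) ⟨
    w′ (q * p) ℚ.- w′ q                  ≡⟨ cong (λ d → w′ d ℚ.- w′ q) eq′ ⟨
    w′ (quot (n * p) k) ℚ.- w′ q         ∎
    where
    eq′ : quot (n * p) k ≡ q * p
    eq′ = trans (cong (λ m → quot m k) (begin
      n * p        ≡⟨ cong (_* p) eq ⟩
      q * k * p    ≡⟨ ℕ.*-assoc q k p ⟩
      q * (k * p)  ≡⟨ cong (q *_) (ℕ.*-comm k p) ⟩
      q * (p * k)  ≡⟨ ℕ.*-assoc q p k ⟨
      q * p * k    ∎)) (quot-* (q * p) k)
  weight k | no k∤n = begin
    w (quot (n * p) k)            ≡⟨ unsieved ⟩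
    w′ (quot (n * p) k)           ≡⟨ ℚ.+-identityʳ _ ⟨
    w′ (quot (n * p) k) ℚ.- 0ℚ    ≡⟨ cong (λ x → w′ (quot (n * p) k) ℚ.- x) w′0 ⟨
    w′ (quot (n * p) k) ℚ.- w′ 0  ∎
    where
    unsieved : w (quot (n * p) k) ≡ w′ (quot (n * p) k)
    unsieved with k ∣? n * p
    ... | no  _ = trans w0 (sym w′0)
    ... | yes (divides q eq) = sym (sieve-∤ w λ (divides e q≡ep) →
      k∤n (divides e (ℕ.*-cancelʳ-≡ n (e * k) p (begin
        n * p        ≡⟨ eq ⟩
        q * k        ≡⟨ cong (_* k) q≡ep ⟩
        e * p * k    ≡⟨ ℕ.*-assoc e p k ⟩
        e * (p * k)  ≡⟨ cong (e *_) (ℕ.*-comm p k) ⟩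
        e * (k * p)  ≡⟨ ℕ.*-assoc e k p ⟨
        e * k * p    ∎))))

-- Nonnegative expressions closed under dilation and difference.

-- Expressions in k with ⟦ pow a ⟧ = t^(ak) and ⟦ gap a ⟧ = t^(ak) - 1.  They are nonnegative
-- for t ≥ 1 and closed under f ↦ f(kp) and f ↦ f(kp) - f(k).
data Expr : Set where
  pow gap : ℕ → Expr
  _⊕_ _⊗_ : Expr → Expr → Expr

dilate : ℕ → Expr → Expr
dilate p (pow a) = pow (a * p)
dilate p (gap a) = gap (a * p)
dilate p (e ⊕ f) = dilate p e ⊕ dilate p f
dilate p (e ⊗ f) = dilate p e ⊗ dilate p f

-- No minus sign appears, by `t^(akp) - t^(ak) = t^(ak) (t^(a(p-1)k) -
-- 1)` and the product rule `e′f′ - ef = (e′ - e)f′ + e(f′ -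
-- f)`, where primes denote dilation by `p`. The constant in `gap a` cancels, so it has the same
-- difference as `pow a`.
diff : ℕ → Expr → Expr
diff p (pow a) = pow a ⊗ gap (a * (p ∸ 1))
diff p (gap a) = pow a ⊗ gap (a * (p ∸ 1))
diff p (e ⊕ f) = diff p e ⊕ diff p f
diff p (e ⊗ f) = (diff p e ⊗ dilate p f) ⊕ (e ⊗ diff p f)

module _ (t : ℚ) where

  ⟦_⟧ : Expr → ℕ → ℚ
  ⟦ pow a ⟧ k = t ^ (a * k)
  ⟦ gap a ⟧ k = t ^ (a * k) ℚ.- 1ℚ
  ⟦ e ⊕ f ⟧ k = ⟦ e ⟧ k ℚ.+ ⟦ f ⟧ k
  ⟦ e ⊗ f ⟧ k = ⟦ e ⟧ k ℚ.* ⟦ f ⟧ k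

  ⟦⟧-nonNeg : 1ℚ ℚ.≤ t → ∀ e k → 0ℚ ℚ.≤ ⟦ e ⟧ k
  ⟦⟧-nonNeg 1≤t (pow a) k = ℚ.≤-trans (ℚ.nonNegative⁻¹ 1ℚ) (1≤^ 1≤t (a * k))
  ⟦⟧-nonNeg 1≤t (gap a) k = p≤q⇒0≤q-p (1≤^ 1≤t (a * k))
  ⟦⟧-nonNeg 1≤t (e ⊕ f) k = ℚ.+-mono-≤ (⟦⟧-nonNeg 1≤t e k) (⟦⟧-nonNeg 1≤t f k)
  ⟦⟧-nonNeg 1≤t (e ⊗ f) k = *-nonNeg (⟦⟧-nonNeg 1≤t e k) (⟦⟧-nonNeg 1≤t f k)

  private
    *-swapʳ : ∀ a p k → a * p * k ≡ a * (k * p)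
    *-swapʳ a p k = trans (ℕ.*-assoc a p k) (cong (a *_) (ℕ.*-comm p k))

  dilate-⟦⟧ : ∀ p e k → ⟦ dilate p e ⟧ k ≡ ⟦ e ⟧ (k * p)
  dilate-⟦⟧ p (pow a) k = cong (t ^_) (*-swapʳ a p k)
  dilate-⟦⟧ p (gap a) k = cong (λ m → t ^ m ℚ.- 1ℚ) (*-swapʳ a p k)
  dilate-⟦⟧ p (e ⊕ f) k = cong₂ ℚ._+_ (dilate-⟦⟧ p e k) (dilate-⟦⟧ p f k)
  dilate-⟦⟧ p (e ⊗ f) k = cong₂ ℚ._*_ (dilate-⟦⟧ p e k) (dilate-⟦⟧ p f k)

  pow-diff : ∀ p .{{_ : NonZero p}} a k →
    t ^ (a * k) ℚ.* (t ^ (a * (p ∸ 1) * k) ℚ.- 1ℚ) ≡ t ^ (a * (k * p)) ℚ.- t ^ (a * k)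
  pow-diff (suc p) a k = begin
    x ℚ.* (t ^ (a * p * k) ℚ.- 1ℚ)
      ≡⟨ solve 2 (λ x y → x :* (y :- con 1ℚ) := x :* y :- x) refl x (t ^ (a * p * k)) ⟩
    x ℚ.* t ^ (a * p * k) ℚ.- x
      ≡⟨ cong (ℚ._- x) (^-+ t (a * k) (a * p * k)) ⟨
    t ^ (a * k + a * p * k) ℚ.- x
      ≡⟨ cong (λ m → t ^ m ℚ.- x) exponent ⟩
    t ^ (a * (k * suc p)) ℚ.- x ∎
    where
    open ≡-Reasoning
    x : ℚ
    x = t ^ (a * k)
    exponent : a * k + a * p * k ≡ a * (k * suc p)
    exponent = begin
      a * k + a * p * k    ≡⟨ cong (a * k +_) (*-swapʳ a p k) ⟩
      a * k + a * (k * p)  ≡⟨ ℕ.*-distribˡ-+ a k (k * p) ⟨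
      a * (k + k * p)      ≡⟨ cong (a *_) (ℕ.*-suc k p) ⟨
      a * (k * suc p)      ∎

  diff-⟦⟧ : ∀ p .{{_ : NonZero p}} e k → ⟦ diff p e ⟧ k ≡ ⟦ e ⟧ (k * p) ℚ.- ⟦ e ⟧ k
  diff-⟦⟧ p (pow a) k = pow-diff p a k
  diff-⟦⟧ p (gap a) k = trans (pow-diff p a k)
    (solve 2 (λ x y → x :- y := (x :- con 1ℚ) :- (y :- con 1ℚ)) refl (t ^ (a * (k * p))) (t ^ (a * k)))
  diff-⟦⟧ p (e ⊕ f) k = trans (cong₂ ℚ._+_ (diff-⟦⟧ p e k) (diff-⟦⟧ p f k))
    (solve 4 (λ e′ e f′ f → (e′ :- e) :+ (f′ :- f) := (e′ :+ f′) :- (e :+ f)) refl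
      (⟦ e ⟧ (k * p)) (⟦ e ⟧ k) (⟦ f ⟧ (k * p)) (⟦ f ⟧ k))
  diff-⟦⟧ p (e ⊗ f) k = trans
    (cong₂ (λ x y → x ℚ.+ ⟦ e ⟧ k ℚ.* y)
      (cong₂ ℚ._*_ (diff-⟦⟧ p e k) (dilate-⟦⟧ p f k)) (diff-⟦⟧ p f k))
    (solve 4 (λ e′ e f′ f → (e′ :- e) :* f′ :+ e :* (f′ :- f) := e′ :* f′ :- e :* f) refl
      (⟦ e ⟧ (k * p)) (⟦ e ⟧ k) (⟦ f ⟧ (k * p)) (⟦ f ⟧ k))

  -- Nonnegativity of the convolutions.

  conv-1 : ∀ {w} f → MöbiusLike w → conv w 1 f ≡ f 1
  conv-1 {w} f W = begin
    w 0 ℚ.* f 0 ℚ.+ (w 1 ℚ.* f 1 ℚ.+ 0ℚ)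
      ≡⟨ cong₂ (λ x y → x ℚ.* f 0 ℚ.+ (y ℚ.* f 1 ℚ.+ 0ℚ)) (w[0] W) (w[1] W) ⟩
    0ℚ ℚ.* f 0 ℚ.+ (1ℚ ℚ.* f 1 ℚ.+ 0ℚ)
      ≡⟨ solve 2 (λ x y → con 0ℚ :* x :+ (con 1ℚ :* y :+ con 0ℚ) := y) refl (f 0) (f 1) ⟩
    f 1 ∎
    where open ≡-Reasoning

  -- Induction on the list of primes, with `w` and `e` general because removing a prime may change
  -- both. Once no prime is left, the convolution is the value of a nonnegative expression at 1.
  conv-product-nonNeg : 1ℚ ℚ.≤ t → ∀ {w ps} → MöbiusLike w → All Prime ps → ∀ e →
    0ℚ ℚ.≤ conv w (product ps) ⟦ e ⟧
  conv-product-nonNeg 1≤t W [] e =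
    subst (0ℚ ℚ.≤_) (sym (conv-1 ⟦ e ⟧ W)) (⟦⟧-nonNeg 1≤t e 1)
  conv-product-nonNeg 1≤t {w} {p ∷ ps} W (p-prime ∷ ps-prime) e
    rewrite ℕ.*-comm p (product ps) with atPrime W p-prime
  ... | inj₁ vanish = subst (0ℚ ℚ.≤_)
    (trans (∑-cong (suc (product ps)) (λ {k} _ → cong (w (quot (product ps) k) ℚ.*_) (dilate-⟦⟧ p e k)))
      (sym (conv-vanish {w} (product ps) {{productOfPrimes≢0 ps-prime}} ⟦ e ⟧ p-prime (w[0] W) vanish)))
    (conv-product-nonNeg 1≤t W ps-prime (dilate p e))
  ... | inj₂ flip = subst (0ℚ ℚ.≤_)
    (trans (∑-cong (suc (product ps)) (λ {k} _ → cong (sieve p w (quot (product ps) k) ℚ.*_)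
             (diff-⟦⟧ p {{prime⇒nonZero p-prime}} e k)))
      (sym (conv-flip {w} (product ps) {{productOfPrimes≢0 ps-prime}} ⟦ e ⟧ p-prime (w[0] W) flip)))
    (conv-product-nonNeg 1≤t (sieve-möbiusLike p-prime W) ps-prime (diff p e))

  conv-pow-nonNeg : 1ℚ ℚ.≤ t → ∀ {w} n .{{_ : NonZero n}} → MöbiusLike w → 0ℚ ℚ.≤ conv w n (t ^_)
  conv-pow-nonNeg 1≤t {w} n W = subst (0ℚ ℚ.≤_)
    (trans (cong (λ m → conv w m ⟦ pow 1 ⟧) (sym (isFactorisation n-factorised)))
      (∑-cong (suc n) (λ {k} _ → cong (λ m → w (quot n k) ℚ.* t ^ m) (ℕ.*-identityˡ k))))
    (conv-product-nonNeg 1≤t W (factorsPrime n-factorised) (pow 1))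
    where
    open PrimeFactorisation
    n-factorised : PrimeFactorisation n
    n-factorised = factorise n

-- Integers as rationals.

ι : ℤ → ℚ
ι z = z ℚ./ 1

-- The sum is computed in the unnormalised rationals, where the denominators stay 1 and no reduction
-- of fractions interferes.
ι-+ : ∀ a b → ι (a ℤ.+ b) ≡ ι a ℚ.+ ι b
ι-+ a b = ℚ.toℚᵘ-injective (begin
  ℚ.toℚᵘ (ι (a ℤ.+ b))              ≈⟨ ℚ.toℚᵘ-fromℚᵘ (ℚᵘ.mkℚᵘ (a ℤ.+ b) 0) ⟩
  ℚᵘ.mkℚᵘ (a ℤ.+ b) 0               ≡⟨ cong₂ (λ x y → ℚᵘ.mkℚᵘ (x ℤ.+ y) 0) (ℤ.*-identityʳ a) (ℤ.*-identityʳ b) ⟨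
  ℚᵘ.mkℚᵘ a 0 ℚᵘ.+ ℚᵘ.mkℚᵘ b 0      ≈⟨ ℚᵘ.+-cong (ℚ.toℚᵘ-fromℚᵘ (ℚᵘ.mkℚᵘ a 0)) (ℚ.toℚᵘ-fromℚᵘ (ℚᵘ.mkℚᵘ b 0)) ⟨
  ℚ.toℚᵘ (ι a) ℚᵘ.+ ℚ.toℚᵘ (ι b)    ≈⟨ ℚ.toℚᵘ-homo-+ (ι a) (ι b) ⟨
  ℚ.toℚᵘ (ι a ℚ.+ ι b)              ∎)
  where open ℚᵘ.≃-Reasoning

ι-neg : ∀ a → ι (ℤ.- a) ≡ - ι a
ι-neg a = begin
  ι (ℤ.- a)                        ≡⟨ solve 2 (λ x y → x := (x :+ y) :- y) refl (ι (ℤ.- a)) (ι a) ⟩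
  ι (ℤ.- a) ℚ.+ ι a ℚ.- ι a        ≡⟨ cong (ℚ._- ι a) (ι-+ (ℤ.- a) a) ⟨
  ι (ℤ.- a ℤ.+ a) ℚ.- ι a          ≡⟨ cong (λ z → ι z ℚ.- ι a) (ℤ.+-inverseˡ a) ⟩
  0ℚ ℚ.- ι a                       ≡⟨ ℚ.+-identityˡ (- ι a) ⟩
  - ι a                            ∎
  where open ≡-Reasoning

-- The Möbius function at multiples of a prime.

μ-square : ∀ m .{{_ : NonZero m}} → HasSquareDivisor m → μ m ≡ 0ℤ
μ-square m sq with hasSquareDivisor? m
... | yes _   = refl
... | no  ¬sq = contradiction sq ¬sq

μ-squarefree : ∀ m .{{_ : NonZero m}} → ¬ HasSquareDivisor m →
  μ m ≡ -1ℤ ℤ.^ length (factors (factorise m))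
μ-squarefree m ¬sq with hasSquareDivisor? m
... | yes sq = contradiction sq ¬sq
... | no  _  = refl

-- Prepending `p` to the factors of `e` gives a factorisation of `e * p`, which by uniqueness is a
-- permutation of the computed one.
length-factors-* : ∀ {p} e .{{_ : NonZero e}} .{{_ : NonZero (e * p)}} → Prime p →
  length (factors (factorise (e * p))) ≡ suc (length (factors (factorise e)))
length-factors-* {p} e p-prime = ↭-length (factorisationUnique (factorise (e * p)) (record
  { factors         = p ∷ factors (factorise e)
  ; isFactorisation = trans (ℕ.*-comm e p) (cong (p *_) (isFactorisation (factorise e)))
  ; factorsPrime    = p-prime ∷ factorsPrime (factorise e)
  }))
  where open PrimeFactorisation

prime∤⇒coprime : ∀ {p d} → Prime p → ¬ p ∣ d → Coprime d p
prime∤⇒coprime p-prime p∤d (i∣d , i∣p) with prime⇒irreducible p-prime i∣p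
... | inj₁ i≡1  = i≡1
... | inj₂ refl = contradiction i∣d p∤d

-- If `p` divided `d`, then `p * p` would divide `e * p` and so `p` would divide `e`. Hence `d * d`
-- is coprime to `p` and already divides `e`.
squareDivisor-*-prime : ∀ {p} e → Prime p → ¬ p ∣ e → HasSquareDivisor (e * p) → HasSquareDivisor e
squareDivisor-*-prime {p} e p-prime p∤e (d , 1<d , d²∣ep) with p ∣? d
... | yes p∣d = contradiction
  (*-cancelʳ-∣ p {{prime⇒nonZero p-prime}} (∣-trans (*-pres-∣ p∣d p∣d) d²∣ep)) p∤e
... | no  p∤d = d , 1<d , coprime-divisor (prime∤⇒coprime p-prime p∤d²)
                  (subst (d * d ∣_) (ℕ.*-comm e p) d²∣ep)
  where
  p∤d² : ¬ p ∣ d * d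
  p∤d² p∣d² with euclidsLemma d d p-prime p∣d²
  ... | inj₁ p∣d = p∤d p∣d
  ... | inj₂ p∣d = p∤d p∣d

μ-*-prime-∣ : ∀ {p} e .{{_ : NonZero (e * p)}} → Prime p → p ∣ e → μ (e * p) ≡ 0ℤ
μ-*-prime-∣ {p} e p-prime p∣e = μ-square (e * p)
  (p , ℕ.nonTrivial⇒n>1 p {{prime⇒nonTrivial p-prime}} , *-monoˡ-∣ p p∣e)

μ-*-prime-∤ : ∀ {p} e .{{_ : NonZero e}} .{{_ : NonZero (e * p)}} → Prime p → ¬ p ∣ e →
  μ (e * p) ≡ ℤ.- μ e
μ-*-prime-∤ {p} e p-prime p∤e with hasSquareDivisor? e
... | yes (d , 1<d , d²∣e) = μ-square (e * p) (d , 1<d , ∣m⇒∣m*n p d²∣e)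
... | no  ¬sq = begin
  μ (e * p)
    ≡⟨ μ-squarefree (e * p) (¬sq ∘ squareDivisor-*-prime e p-prime p∤e) ⟩
  -1ℤ ℤ.^ length (factors (factorise (e * p)))
    ≡⟨ cong (-1ℤ ℤ.^_) (length-factors-* e p-prime) ⟩
  -1ℤ ℤ.* (-1ℤ ℤ.^ length (factors (factorise e)))
    ≡⟨ ℤ.-1*i≡-i _ ⟩
  ℤ.- (-1ℤ ℤ.^ length (factors (factorise e))) ∎
  where open ≡-Reasoning

-- The value 0 at 0 makes the terms with default quotient vanish.
μ₀ : ℕ → ℚ
μ₀ zero      = 0ℚ
μ₀ m@(suc _) = ι (μ m)

μ₀≡ιμ : ∀ m .{{_ : NonZero m}} → μ₀ m ≡ ι (μ m)
μ₀≡ιμ (suc _) = refl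

μ₀-möbiusLike : MöbiusLike μ₀
μ₀-möbiusLike = record { w[0] = refl ; w[1] = refl ; atPrime = λ p-prime → inj₂ (at p-prime) }
  where
  open ≡-Reasoning
  at : ∀ {p} → Prime p → ∀ e → μ₀ (e * p) ≡ - sieve p μ₀ e
  at {p} p-prime zero = sym (cong -_ (sieve-∣ μ₀ (p ∣0)))
  at {p} p-prime e@(suc _) with p ∣? e
  ... | yes p∣e = trans (μ₀≡ιμ (e * p)) (cong ι (μ-*-prime-∣ e p-prime p∣e))
    where instance ep≢0 = ℕ.m*n≢0 e p {{_}} {{prime⇒nonZero p-prime}}
  ... | no  p∤e = begin
    μ₀ (e * p)    ≡⟨ μ₀≡ιμ (e * p) ⟩
    ι (μ (e * p)) ≡⟨ cong ι (μ-*-prime-∤ e p-prime p∤e) ⟩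
    ι (ℤ.- μ e)   ≡⟨ ι-neg (μ e) ⟩
    - ι (μ e)     ∎
    where instance ep≢0 = ℕ.m*n≢0 e p {{_}} {{prime⇒nonZero p-prime}}

-- Growth of the Mertens sum with `N`.

[r+qk]/k≡q : ∀ r q k .{{_ : NonZero k}} → r < k → (r + q * k) / k ≡ q
[r+qk]/k≡q r q k r<k = begin
  (r + q * k) / k    ≡⟨ ℕ.+-distrib-/-∣ʳ r (n∣m*n q) ⟩
  r / k + q * k / k  ≡⟨ cong₂ _+_ (ℕ.m<n⇒m/n≡0 r<k) (ℕ.m*n/n≡m q k) ⟩
  q                  ∎
  where open ≡-Reasoning

-- Passing from `N` to `N + 1` raises the floor, by one, exactly when `k = i + 1` divides `N + 1`;
-- then `M` gains the summand `μ((N+1)/k)`. Otherwise the quotient is 0 and so is `μ₀`.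
M-floor-suc : ∀ N i → ι (M (suc N / suc i)) ≡ ι (M (N / suc i)) ℚ.+ μ₀ (quot (suc N) (suc i))
M-floor-suc N i with suc i ∣? suc N
... | yes (divides (suc q) eq) = begin
  ι (M (suc N / k))                ≡⟨ cong (ι ∘ M) (trans (ℕ./-congˡ {o = k} eq) (ℕ.m*n/n≡m (suc q) k)) ⟩
  ι (M (suc q))                    ≡⟨ ι-+ (M q) (μ (suc q)) ⟩
  ι (M q) ℚ.+ μ₀ (suc q)           ≡⟨ cong (λ m → ι (M m) ℚ.+ μ₀ (suc q)) floor ⟨
  ι (M (N / k)) ℚ.+ μ₀ (suc q)     ∎
  where
  open ≡-Reasoning
  k : ℕ
  k = suc i
  floor : N / k ≡ q
  floor = trans (ℕ./-congˡ {o = k} (ℕ.suc-injective eq)) ([r+qk]/k≡q i q k ℕ.≤-refl)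
... | no k∤sucN = trans (cong (ι ∘ M) floor) (sym (ℚ.+-identityʳ _))
  where
  k : ℕ
  k = suc i
  decompose : suc N ≡ suc (N % k) + N / k * k
  decompose = cong suc (ℕ.m≡m%n+[m/n]*n N k)
  no-carry : suc (N % k) < k
  no-carry = ℕ.≤∧≢⇒< (ℕ.m%n<n N k) λ full →
    k∤sucN (divides (suc (N / k)) (trans decompose (cong (_+ N / k * k) full)))
  floor : suc N / k ≡ N / k
  floor = trans (ℕ./-congˡ {o = k} decompose) ([r+qk]/k≡q (suc (N % k)) (N / k) k no-carry)

-- The summand with `k = i + 1` after division by `λ^(n+1)`, where `N = n - 1` and `t = 1/λ`.
mertensTerm : ℚ → ℕ → ℕ → ℚ
mertensTerm t N i = ι (M (N / suc i)) ℚ.* t ^ suc i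

mertensSum : ℚ → ℕ → ℚ
mertensSum t N = ∑ N (mertensTerm t N)

-- Summed over `k`, the increments in `M-floor-suc` form the polynomial `P_(N+1)(t)`.
mertensSum-suc : ∀ t N → mertensSum t (suc N) ≡ mertensSum t N ℚ.+ conv μ₀ (suc N) (t ^_)
mertensSum-suc t N = begin
  mertensSum t (suc N)
    ≡⟨ ∑-cong (suc N) (λ {i} _ → trans (cong (ℚ._* t ^ suc i) (M-floor-suc N i))
         (ℚ.*-distribʳ-+ (t ^ suc i) (ι (M (N / suc i))) (μ₀ (quot (suc N) (suc i))))) ⟩
  ∑ (suc N) (λ i → mertensTerm t N i ℚ.+ divisorTerm i)
    ≡⟨ ∑-+ (suc N) (mertensTerm t N) divisorTerm ⟩
  ∑ (suc N) (mertensTerm t N) ℚ.+ rest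
    ≡⟨ cong (ℚ._+ rest) (∑-last N (mertensTerm t N)) ⟩
  mertensSum t N ℚ.+ ι (M (N / suc N)) ℚ.* t ^ suc N ℚ.+ rest
    -- The extra term `k = N + 1` of the old sum has floor 0, and `M 0` is 0.
    ≡⟨ cong (λ m → mertensSum t N ℚ.+ ι (M m) ℚ.* t ^ suc N ℚ.+ rest) (ℕ.m<n⇒m/n≡0 (ℕ.n<1+n N)) ⟩
  mertensSum t N ℚ.+ 0ℚ ℚ.* t ^ suc N ℚ.+ rest
    -- The product `0ℚ ℚ.* 1ℚ` is the term `k = 0` of `conv`, in its computed form.
    ≡⟨ solve 3 (λ a b c → a :+ con 0ℚ :* b :+ c := a :+ (con 0ℚ :* con 1ℚ :+ c)) refl
         (mertensSum t N) (t ^ suc N) rest ⟩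
  mertensSum t N ℚ.+ (0ℚ ℚ.* 1ℚ ℚ.+ rest) ∎
  where
  open ≡-Reasoning
  divisorTerm : ℕ → ℚ
  divisorTerm i = μ₀ (quot (suc N) (suc i)) ℚ.* t ^ suc i
  rest : ℚ
  rest = ∑ (suc N) divisorTerm

t≤mertensSum : ∀ {t} → 1ℚ ℚ.≤ t → ∀ N → t ℚ.≤ mertensSum t (suc N)
t≤mertensSum {t} 1≤t zero = ℚ.≤-reflexive (sym (begin
  mertensSum t 1               ≡⟨ mertensSum-suc t 0 ⟩
  0ℚ ℚ.+ conv μ₀ 1 (t ^_)      ≡⟨ ℚ.+-identityˡ _ ⟩
  conv μ₀ 1 (t ^_)             ≡⟨ conv-1 t (t ^_) μ₀-möbiusLike ⟩
  t ℚ.* 1ℚ                     ≡⟨ ℚ.*-identityʳ t ⟩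
  t                            ∎))
  where open ≡-Reasoning
t≤mertensSum {t} 1≤t (suc N) = begin
  t                                                          ≡⟨ ℚ.+-identityʳ t ⟨
  t ℚ.+ 0ℚ                                                   ≤⟨ ℚ.+-mono-≤ (t≤mertensSum 1≤t N)
                                                                  (conv-pow-nonNeg t 1≤t (suc (suc N)) μ₀-möbiusLike) ⟩
  mertensSum t (suc N) ℚ.+ conv μ₀ (suc (suc N)) (t ^_)      ≡⟨ mertensSum-suc t (suc N) ⟨
  mertensSum t (suc (suc N))                                 ∎
  where open ℚ.≤-Reasoning

-- The inequality for rational `λ`, with an explicit gap.

suc[N]+1≡N∸i+1+suc[i] : ∀ {N i} → i < N → suc N + 1 ≡ N ∸ i + 1 + suc i
suc[N]+1≡N∸i+1+suc[i] {N} {i} i<N = begin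
  suc N + 1            ≡⟨ cong (λ m → suc m + 1) (ℕ.m∸n+n≡m (ℕ.<⇒≤ i<N)) ⟨
  suc (N ∸ i + i) + 1  ≡⟨ cong (_+ 1) (ℕ.+-suc (N ∸ i) i) ⟨
  N ∸ i + suc i + 1    ≡⟨ ℕ.+-assoc (N ∸ i) (suc i) 1 ⟩
  N ∸ i + (suc i + 1)  ≡⟨ cong (N ∸ i +_) (ℕ.+-comm (suc i) 1) ⟩
  N ∸ i + (1 + suc i)  ≡⟨ ℕ.+-assoc (N ∸ i) 1 (suc i) ⟨
  N ∸ i + 1 + suc i    ∎
  where open ≡-Reasoning

-- Multiplying `t - 1 ≤ mertensSum t N - 1` by `q^(n+1)` gives this, since `qt = 1`. The gap is kept
-- explicit because strictness between reals needs a separation uniform in the index.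
rational-bound : ∀ {q} → 0ℚ ℚ.< q → q ℚ.< 1ℚ → ∀ N .{{_ : NonZero N}} →
  q ^ suc N ℚ.* (1ℚ ℚ.- q) ℚ.≤
  ∑ N (λ i → ι (M (N / suc i)) ℚ.* q ^ (N ∸ i + 1)) ℚ.- q ^ (suc N + 1)
rational-bound {q} 0<q q<1 N@(suc N-1) = begin
  q ^ suc N ℚ.* (1ℚ ℚ.- q)
    ≡⟨ cong (λ x → q ^ suc N ℚ.* (x ℚ.- q)) qt≡1 ⟨
  q ^ suc N ℚ.* (q ℚ.* t ℚ.- q)
    ≡⟨ solve 3 (λ q a t → a :* (q :* t :- q) := a :* (q :* con 1ℚ) :* (t :- con 1ℚ)) refl q (q ^ suc N) t ⟩
  q ^ suc N ℚ.* q ^ 1 ℚ.* (t ℚ.- 1ℚ)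
    ≡⟨ cong (ℚ._* (t ℚ.- 1ℚ)) (^-+ q (suc N) 1) ⟨
  Q ℚ.* (t ℚ.- 1ℚ)
    ≤⟨ ℚ.*-monoˡ-≤-nonNeg Q {{ℚ.nonNegative (ℚ.<⇒≤ (^-pos 0<q (suc N + 1)))}}
         (ℚ.+-monoˡ-≤ (- 1ℚ) (t≤mertensSum 1≤t N-1)) ⟩
  Q ℚ.* (mertensSum t N ℚ.- 1ℚ)
    ≡⟨ solve 2 (λ a b → a :* (b :- con 1ℚ) := a :* b :- a) refl Q (mertensSum t N) ⟩
  Q ℚ.* mertensSum t N ℚ.- Q
    ≡⟨ cong (ℚ._- Q) (trans (sym (∑-* N Q (mertensTerm t N))) (∑-cong N term)) ⟩
  ∑ N (λ i → ι (M (N / suc i)) ℚ.* q ^ (N ∸ i + 1)) ℚ.- Q ∎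
  where
  open ℚ.≤-Reasoning
  instance
    q-pos : ℚ.Positive q
    q-pos = ℚ.positive 0<q
    q≢0 : ℚ.NonZero q
    q≢0 = ℚ.pos⇒nonZero q
  t Q : ℚ
  t = ℚ.1/ q
  Q = q ^ (suc N + 1)
  qt≡1 : q ℚ.* t ≡ 1ℚ
  qt≡1 = ℚ.*-inverseʳ q
  1≤t : 1ℚ ℚ.≤ t
  1≤t = ℚ.*-cancelˡ-≤-pos q (ℚ.≤-trans (ℚ.≤-reflexive (ℚ.*-identityʳ q))
    (ℚ.≤-trans (ℚ.<⇒≤ q<1) (ℚ.≤-reflexive (sym qt≡1))))
  term : ∀ {i} → i < N →
    Q ℚ.* (ι (M (N / suc i)) ℚ.* t ^ suc i) ≡ ι (M (N / suc i)) ℚ.* q ^ (N ∸ i + 1)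
  term {i} i<N = begin-equality
    Q ℚ.* (m ℚ.* t ^ suc i)
      ≡⟨ solve 3 (λ a b c → a :* (b :* c) := b :* (a :* c)) refl Q m (t ^ suc i) ⟩
    m ℚ.* (Q ℚ.* t ^ suc i)
      ≡⟨ cong (λ l → m ℚ.* (q ^ l ℚ.* t ^ suc i)) (suc[N]+1≡N∸i+1+suc[i] i<N) ⟩
    m ℚ.* (q ^ (N ∸ i + 1 + suc i) ℚ.* t ^ suc i)
      ≡⟨ cong (m ℚ.*_) (^-inverse qt≡1 (N ∸ i + 1) (suc i)) ⟩
    m ℚ.* q ^ (N ∸ i + 1) ∎
    where
    m : ℚ
    m = ι (M (N / suc i))

-- Passage to Cauchy reals.

seq-^ : ∀ x n j → seq (x ^ℝ n) j ≡ seq x j ^ n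
seq-^ x zero    j = refl
seq-^ x (suc n) j = cong (seq x j ℚ.*_) (seq-^ x n j)

seq-∑ : ∀ N (f : (k : ℕ) .{{_ : NonZero k}} → ℝ) j → seq (∑ℝ N f) j ≡ ∑ N (λ i → seq (f (suc i)) j)
seq-∑ zero    f j = refl
seq-∑ (suc N) f j = trans (cong (ℚ._+ seq (f (suc N)) j) (seq-∑ N f j))
  (sym (∑-last N (λ i → seq (f (suc i)) j)))

theorem1p3 : (n : ℕ) → 2 ≤ n → (x : ℝ) → 0ℝ <ℝ x → x <ℝ 1ℝ →
    ∑ℝ (n ∸ 1) (λ k → fromℤ (M ((n ∸ 1) / k)) *ℝ x ^ℝ (n ∸ k + 1)) >ℝ x ^ℝ (n + 1)
theorem1p3 n@(suc N@(suc _)) (s≤s (s≤s _)) x (δ , 0<δ , K , x>δ) (η , 0<η , L , x<1-η) =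
  -- From index `K ⊔ L` on, the terms `q` of `x` satisfy `δ < q` and `η < 1 - q`, so `δ^n η` lies
  -- below the gap `q^n (1 - q)` of `rational-bound` and does not depend on the index.
  δ ^ n ℚ.* η , *-pos (^-pos 0<δ n) 0<η , K ℕ.⊔ L , λ j K⊔L≤j →
    let q   = seq x j
        δ<q = subst (δ ℚ.<_) (ℚ.+-identityʳ q) (x>δ j (ℕ.m⊔n≤o⇒m≤o K L K⊔L≤j))
        η<  = x<1-η j (ℕ.m⊔n≤o⇒n≤o K L K⊔L≤j)
        0<q = ℚ.<-trans 0<δ δ<q
    in begin-strict
    δ ^ n ℚ.* η
      <⟨ ℚ.*-monoʳ-<-pos (δ ^ n) {{ℚ.positive (^-pos 0<δ n)}} η< ⟩
    δ ^ n ℚ.* (1ℚ ℚ.- q)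
      ≤⟨ ℚ.*-monoʳ-≤-nonNeg (1ℚ ℚ.- q) {{ℚ.nonNegative (ℚ.<⇒≤ (ℚ.<-trans 0<η η<))}}
           (^-mono-≤ 0<δ δ<q n) ⟩
    q ^ n ℚ.* (1ℚ ℚ.- q)
      ≤⟨ rational-bound 0<q (0<1-q⇒q<1 q (ℚ.<-trans 0<η η<)) N ⟩
    ∑ N (λ i → ι (M (N / suc i)) ℚ.* q ^ (N ∸ i + 1)) ℚ.- q ^ (n + 1)
      ≡⟨ cong₂ ℚ._-_
           (trans (∑-cong N (λ {i} _ → cong (ι (M (N / suc i)) ℚ.*_) (sym (seq-^ x (N ∸ i + 1) j))))
             (sym (seq-∑ N (λ k → fromℤ (M (N / k)) *ℝ x ^ℝ (n ∸ k + 1)) j)))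
           (sym (seq-^ x (n + 1) j)) ⟩
    seq (∑ℝ N (λ k → fromℤ (M (N / k)) *ℝ x ^ℝ (n ∸ k + 1))) j ℚ.- seq (x ^ℝ (n + 1)) j ∎
  where
  open ℚ.≤-Reasoning
  0<1-q⇒q<1 : ∀ q → 0ℚ ℚ.< 1ℚ ℚ.- q → q ℚ.< 1ℚ
  0<1-q⇒q<1 q 0<1-q = subst₂ ℚ._<_ (ℚ.+-identityˡ q)
    (solve 1 (λ q → (con 1ℚ :- q) :+ q := con 1ℚ) refl q) (ℚ.+-monoˡ-< q 0<1-q)
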